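{- Let $G$ and $H$ be two finite groups, written additively, with $|G|=2^n$ and $|H|=4$, and let $F\colon G\to H$ be a perfect nonlinear function. Then there are only two possible preimage distributions for $F$, namely the two extremal ones: either for some $\alpha\in H$, $|F^{ -1}(\alpha)|=\frac{|G|}{|H|}-\sqrt{|G|}+\frac{\sqrt{|G|}}{|H|}$ and $|F^{ -1}(\beta)|=\frac{|G|}{|H|}+\frac{\sqrt{|G|}}{|H|}$ for each $\beta\neq\alpha$; or for some $\alpha\in H$, $|F^{ -1}(\alpha)|=\frac{|G|}{|H|}+\sqrt{|G|}-\frac{\sqrt{|G|}}{|H|}$ and $|F^{ -1}(\beta)|=\frac{|G|}{|H|}-\frac{\sqrt{|G|}}{|H|}$ for each $\beta\neq\alpha$.
   Context: A function $F\colon G\to H$ between finite groups (written additively, not necessarily abelian) is perfect nonlinear if $|\{x\in G: F(x+a)-F(x)=b\}|=|G|/|H|$ for all $a\in G\setminus\{0\}$ and all $b\in H$. The preimage distribution of $F$ is the multiset of the sizes $|F^{ -1}(\beta)|$, $\beta\in H$. -}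

module Defs where

open import Level using (Level; _⊔_; suc)
open import Algebra.Bundles using (Group)
open import Data.Fin.Base using (Fin)
open import Data.Fin.Properties using (nonZeroIndex) renaming (_≟_ to _≟ᶠ_)
open import Data.Integer.Base using (+_)
open import Data.Nat.Base using (ℕ; NonZero)
open import Data.Product.Base using (_×_)
open import Data.Rational.Base using (ℚ; 0ℚ; _/_; _*_; _≤_)
open import Data.Vec.Base using (count; tabulate)
open import Function.Bundles using (Func; Inverse)
open import Function.Properties.Inverse using (Inverse⇒Injection)
open import Relation.Binary.Definitions using () renaming (Decidable to Decidable₂)
open import Relation.Binary.PropositionalEquality using (_≡_) renaming (setoid to ≡-setoid)
open import Relation.Nullary using (¬_)
open import Relation.Nullary.Decidable using (via-injection)
open import Relation.Unary using (Pred; Decidable)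

private variable
  a b c d ℓ ℓ′ p : Level

-- Written additively, but not assumed commutative; x - y is x + (- y).
record FiniteGroup c ℓ : Set (suc (c ⊔ ℓ)) where
  field
    group : Group c ℓ

  open Group group public
    using (Carrier; _≈_; setoid)
    renaming (_∙_ to _+_; ε to 0#; _⁻¹ to -_; _//_ to _-_)

  field
    order       : ℕ
    enumeration : Inverse setoid (≡-setoid (Fin order))

  open Inverse enumeration public
    using () renaming (to to index; from to element)

  infix 4 _≟_
  _≟_ : Decidable₂ _≈_
  _≟_ = via-injection (Inverse⇒Injection enumeration) _≟ᶠ_

  instance
    order-nonZero : NonZero order
    order-nonZero = nonZeroIndex (index 0#)

  -- `element` lists one representative of each ≈-class, so for P respecting ≈
  -- this is the number of group elements satisfying P.
  card : {P : Pred Carrier p} → Decidable P → ℕ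
  card P? = count P? (tabulate element)

open FiniteGroup using (order)

infix 7 ∣_∣/∣_∣
∣_∣/∣_∣ : FiniteGroup a b → FiniteGroup c d → ℚ
∣ G ∣/∣ H ∣ = + order G / order H
  where instance _ = FiniteGroup.order-nonZero H

1/∣_∣ : FiniteGroup c ℓ → ℚ
1/∣ H ∣ = + 1 / order H
  where instance _ = FiniteGroup.order-nonZero H

ℕ→ℚ : ℕ → ℚ
ℕ→ℚ k = + k / 1

-- The nonnegative square root. Rationals suffice where √m occurs in an equation
-- q + r √m = s with q, r, s rational and r ≠ 0: such an equation forces √m ∈ ℚ.
_IsSqrtOf_ : ℚ → ℕ → Set
r IsSqrtOf m = 0ℚ ≤ r × r * r ≡ ℕ→ℚ m

module _ (G : FiniteGroup a b) (H : FiniteGroup c d) where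
  private
    module G = FiniteGroup G
    module H = FiniteGroup H

  GroupFunction : Set (a ⊔ b ⊔ c ⊔ d)
  GroupFunction = Func G.setoid H.setoid

  module _ (F : GroupFunction) where
    open Func F using () renaming (to to f)

    PerfectNonlinear : Set (a ⊔ b ⊔ c)
    PerfectNonlinear =
      ∀ (u : G.Carrier) → ¬ (u G.≈ G.0#) → ∀ (v : H.Carrier) →
      ℕ→ℚ (G.card (λ x → (f (x G.+ u) H.- f x) H.≟ v)) ≡ ∣ G ∣/∣ H ∣

    -- |F⁻¹(β)|, as a rational so that it can be compared with |G|/|H|.
    ∣preimage∣ : H.Carrier → ℚ
    ∣preimage∣ β = ℕ→ℚ (G.card (λ x → f x H.≟ β))

{-# OPTIONS --safe #-}

-- Let x_β = |F⁻¹(β)| and N = |G| = 2ⁿ.  Counting the pairs (g, g + u) with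
-- F (g + u) - F g = v turns perfect nonlinearity into the autocorrelations
-- 4 Σ_β x_β² = N² + 3N and 4 Σ_β x_β x_{v+β} = N² - N for v ≠ 0.  A group of order 4
-- has an involution v = b, so H = {b + d, d} ∪ {b, 0}, and with x, y and z, w the
-- preimage sizes over these two cosets, t = 2(x + y) - N satisfies t² = N and
-- (x - y)² + (z - w)² = t².  As t² is a power of 2, descent modulo 4 shows that one
-- of the two squares vanishes, and then all preimage sizes are determined by ±t.
module Submission where

open import Algebra.Bundles using (Group)
import Algebra.Properties.Group as GroupProperties
import Algebra.Properties.Semiring.Sum as SemiringSum
open import Data.Bool.Base using (if_then_else_)
open import Data.Fin.Base using (Fin; zero; suc)
open import Data.Fin.Patterns using (0F; 1F; 2F; 3F)
open import Data.Fin.Permutation using (Permutation; permutation; _⟨$⟩ʳ_)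
open import Data.Fin.Properties using (any?; ¬∀⟶∃¬; injective⇒≤; suc-injective) renaming (_≟_ to _≟ᶠ_)
open import Data.Integer.Base as ℤ using (ℤ; +_; -[1+_]; ∣_∣)
import Data.Integer.Properties as ℤ
import Data.Integer.Tactic.RingSolver as ℤ-RingSolver
import Data.Nat.Base as ℕ
import Data.Nat.Divisibility as ℕ
import Data.Nat.Primality as ℕ
import Data.Nat.Properties as ℕ
import Data.Nat.Tactic.RingSolver as ℕ-RingSolver
open import Data.Product.Base as Product using (∃; _,_; proj₁; proj₂)
open import Data.Rational.Base as ℚ using (_/_; fromℚᵘ; toℚᵘ)
import Data.Rational.Properties as ℚ
open import Data.Rational.Solver using (module +-*-Solver)
open import Data.Rational.Unnormalised.Base as ℚᵘ using (mkℚᵘ; *≡*)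
import Data.Rational.Unnormalised.Properties as ℚᵘ
open import Data.Sum.Base as Sum using (inj₁; inj₂; [_,_]′)
open import Data.Vec.Base using (count; tabulate)
open import Data.Vec.Functional using (Vector; []; _∷_)
open import Function.Base using (_∘_; id; case_of_)
open import Function.Bundles using (Func; Inverse)
open import Level using (Level)
open import Relation.Binary.PropositionalEquality
  using (_≢_; refl; sym; trans; cong; cong₂; subst; module ≡-Reasoning)
open import Relation.Nullary using (Dec; yes; no; does; contradiction)
open import Relation.Nullary.Decidable using (from-no)
open import Relation.Unary using (Pred; Decidable)

open import Defs
open import Data.Nat.Base using (ℕ; zero; suc; _^_)
open import Data.Product.Base using (_×_; ∃-syntax)
open import Data.Sum.Base using (_⊎_)
open import Relation.Binary.PropositionalEquality using (_≡_)
open import Relation.Nullary using (¬_)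

-- Integer arithmetic: squares modulo 4 and sums of two squares.

module IntegerArithmetic where
  open import Data.Integer.Base using (_+_; _*_; _-_; -_)
  open SemiringSum ℤ.+-*-semiring using (sum; sum-syntax)

  2∣n*n⇒2∣n : ∀ n → 2 ℕ.∣ n ℕ.* n → 2 ℕ.∣ n
  2∣n*n⇒2∣n n = [ id , id ]′ ∘ ℕ.euclidsLemma n n ℕ.prime[2]

  even∨odd : ∀ n → ∃[ k ] (n ≡ k ℕ.* 2 ⊎ n ≡ suc (k ℕ.* 2))
  even∨odd zero = 0 , inj₁ refl
  even∨odd (suc n) with even∨odd n
  ... | k , inj₁ refl = k , inj₂ refl
  ... | k , inj₂ refl = suc k , inj₁ refl

  -- Squares are 0 or 1 modulo 4, so an odd `m` would leave remainder 1 or 2, according to the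
  -- parity of `n`.
  4∣m²+n²⇒2∣m : ∀ m n → 4 ℕ.∣ m ℕ.* m ℕ.+ n ℕ.* n → 2 ℕ.∣ m
  4∣m²+n²⇒2∣m m n 4∣ with even∨odd m | even∨odd n
  ... | j , inj₁ refl | _ = ℕ.n∣m*n j
  ... | j , inj₂ refl | k , inj₁ refl = contradiction
    (ℕ.∣m+n∣m⇒∣n (subst (4 ℕ.∣_) (lemma j k) 4∣) (ℕ.n∣m*n (j ℕ.* j ℕ.+ j ℕ.+ k ℕ.* k)))
    (from-no (4 ℕ.∣? 1))
    where
    lemma : ∀ j k → suc (j ℕ.* 2) ℕ.* suc (j ℕ.* 2) ℕ.+ (k ℕ.* 2) ℕ.* (k ℕ.* 2)
                  ≡ (j ℕ.* j ℕ.+ j ℕ.+ k ℕ.* k) ℕ.* 4 ℕ.+ 1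
    lemma = ℕ-RingSolver.solve-∀
  ... | j , inj₂ refl | k , inj₂ refl = contradiction
    (ℕ.∣m+n∣m⇒∣n (subst (4 ℕ.∣_) (lemma j k) 4∣) (ℕ.n∣m*n (j ℕ.* j ℕ.+ j ℕ.+ k ℕ.* k ℕ.+ k)))
    (from-no (4 ℕ.∣? 2))
    where
    lemma : ∀ j k → suc (j ℕ.* 2) ℕ.* suc (j ℕ.* 2) ℕ.+ suc (k ℕ.* 2) ℕ.* suc (k ℕ.* 2)
                  ≡ (j ℕ.* j ℕ.+ j ℕ.+ k ℕ.* k ℕ.+ k) ℕ.* 4 ℕ.+ 2
    lemma = ℕ-RingSolver.solve-∀

  [k*2]² : ∀ k → (k ℕ.* 2) ℕ.* (k ℕ.* 2) ≡ 4 ℕ.* (k ℕ.* k)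
  [k*2]² = ℕ-RingSolver.solve-∀

  -- Descent by two exponents at a time. From exponent 2 on, `c` is even, so 4 divides `c²` and
  -- hence the sum of squares, which makes `a` and `b` even; halving all three numbers keeps both
  -- equations and lowers the exponent by 2.
  pythagorean-2^n : ∀ n a b c → c ℕ.* c ≡ 2 ^ n → a ℕ.* a ℕ.+ b ℕ.* b ≡ c ℕ.* c → a ≡ 0 ⊎ b ≡ 0
  pythagorean-2^n 0 zero    b c c²≡ a²+b²≡c² = inj₁ refl
  pythagorean-2^n 0 (suc a) b c c²≡ a²+b²≡c² = inj₂ ([ id , id ]′ (ℕ.m*n≡0⇒m≡0∨n≡0 b
    (ℕ.m+n≡0⇒n≡0 (a ℕ.+ a ℕ.* suc a) (ℕ.suc-injective (trans a²+b²≡c² c²≡)))))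
  -- No square equals 2: `c` would be even, and 4 would divide 2.
  pythagorean-2^n 1 a b c c²≡ a²+b²≡c²
    with ℕ.divides k refl ← 2∣n*n⇒2∣n c (ℕ.divides 1 c²≡) = contradiction
    (ℕ.divides (k ℕ.* k) (trans (sym c²≡) (trans ([k*2]² k) (ℕ.*-comm 4 (k ℕ.* k))))) (from-no (4 ℕ.∣? 2))
  pythagorean-2^n (suc (suc n)) a b c c²≡ a²+b²≡c²
    with ℕ.divides k refl ← 2∣n*n⇒2∣n c (subst (2 ℕ.∣_) (sym c²≡) (ℕ.m∣m*n (2 ^ suc n)))
    with 4∣ ← subst (4 ℕ.∣_) (trans (sym ([k*2]² k)) (sym a²+b²≡c²)) (ℕ.m∣m*n (k ℕ.* k))
    with ℕ.divides i refl ← 4∣m²+n²⇒2∣m a b 4∣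
       | ℕ.divides j refl ← 4∣m²+n²⇒2∣m b a (subst (4 ℕ.∣_) (ℕ.+-comm (a ℕ.* a) (b ℕ.* b)) 4∣)
    = Sum.map (cong (ℕ._* 2)) (cong (ℕ._* 2)) (pythagorean-2^n n i j k
      (ℕ.*-cancelˡ-≡ _ _ 4 (trans (sym ([k*2]² k)) (trans c²≡ (sym (ℕ.*-assoc 2 2 (2 ^ n))))))
      (ℕ.*-cancelˡ-≡ _ _ 4 (begin
        4 ℕ.* (i ℕ.* i ℕ.+ j ℕ.* j)                            ≡⟨ ℕ.*-distribˡ-+ 4 (i ℕ.* i) (j ℕ.* j) ⟩
        4 ℕ.* (i ℕ.* i) ℕ.+ 4 ℕ.* (j ℕ.* j)                    ≡⟨ cong₂ ℕ._+_ ([k*2]² i) ([k*2]² j) ⟨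
        (i ℕ.* 2) ℕ.* (i ℕ.* 2) ℕ.+ (j ℕ.* 2) ℕ.* (j ℕ.* 2)    ≡⟨ a²+b²≡c² ⟩
        (k ℕ.* 2) ℕ.* (k ℕ.* 2)                                ≡⟨ [k*2]² k ⟩
        4 ℕ.* (k ℕ.* k)                                        ∎)))
    where open ≡-Reasoning

  ∣i∣²≡i² : ∀ i → + (∣ i ∣ ℕ.* ∣ i ∣) ≡ i * i
  ∣i∣²≡i² (+ zero)    = refl
  ∣i∣²≡i² (+ (suc n)) = refl
  ∣i∣²≡i² (-[1+ n ])  = refl

  pythagorean-2^n-ℤ : ∀ n a b c → c * c ≡ + (2 ^ n) → a * a + b * b ≡ c * c → a ≡ + 0 ⊎ b ≡ + 0
  pythagorean-2^n-ℤ n a b c c²≡ a²+b²≡c² = Sum.map ℤ.∣i∣≡0⇒i≡0 ℤ.∣i∣≡0⇒i≡0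
    (pythagorean-2^n n (∣ a ∣) (∣ b ∣) (∣ c ∣)
      (ℤ.+-injective (trans (∣i∣²≡i² c) c²≡))
      (ℤ.+-injective (begin
        + (∣ a ∣ ℕ.* ∣ a ∣ ℕ.+ ∣ b ∣ ℕ.* ∣ b ∣)       ≡⟨ ℤ.pos-+ (∣ a ∣ ℕ.* ∣ a ∣) (∣ b ∣ ℕ.* ∣ b ∣) ⟩
        + (∣ a ∣ ℕ.* ∣ a ∣) + + (∣ b ∣ ℕ.* ∣ b ∣)     ≡⟨ cong₂ _+_ (∣i∣²≡i² a) (∣i∣²≡i² b) ⟩
        a * a + b * b                                 ≡⟨ a²+b²≡c² ⟩
        c * c                                         ≡⟨ ∣i∣²≡i² c ⟨
        + (∣ c ∣ ℕ.* ∣ c ∣)                           ∎)))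
    where open ≡-Reasoning

  i²≡j²⇒i≡j∨i≡-j : ∀ i j → i * i ≡ j * j → i ≡ j ⊎ i ≡ - j
  i²≡j²⇒i≡j∨i≡-j i j i²≡j² = Sum.map (ℤ.i-j≡0⇒i≡j i j)
    (λ i+j≡0 → ℤ.i-j≡0⇒i≡j i (- j) (trans (cong (_+_ i) (ℤ.neg-involutive j)) i+j≡0))
    (ℤ.i*j≡0⇒i≡0∨j≡0 (i - j) (trans (lemma i j) (ℤ.i≡j⇒i-j≡0 i²≡j²)))
    where
    lemma : ∀ i j → (i - j) * (i + j) ≡ i * i - j * j
    lemma = ℤ-RingSolver.solve-∀

  -- Pairs of integers recovered from sum and difference.

  module _ {N x y : ℤ} (t : ℤ) (2[x+y]≡N+t : + 2 * (x + y) ≡ N + t) where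
    open ≡-Reasoning

    private
      4x≡ : ∀ {d} → x - y ≡ d → + 4 * x ≡ N + t + + 2 * d
      4x≡ {d} refl = begin
        + 4 * x                             ≡⟨ lemma x y ⟩
        + 2 * (x + y) + + 2 * (x - y)       ≡⟨ cong (_+ + 2 * d) 2[x+y]≡N+t ⟩
        N + t + + 2 * d                     ∎
        where
        lemma : ∀ x y → + 4 * x ≡ + 2 * (x + y) + + 2 * (x - y)
        lemma = ℤ-RingSolver.solve-∀

      4y≡ : ∀ {d} → x - y ≡ d → + 4 * y ≡ N + t - + 2 * d
      4y≡ {d} refl = begin
        + 4 * y                             ≡⟨ lemma x y ⟩
        + 2 * (x + y) - + 2 * (x - y)       ≡⟨ cong (_- + 2 * d) 2[x+y]≡N+t ⟩
        N + t - + 2 * d                     ∎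
        where
        lemma : ∀ x y → + 4 * y ≡ + 2 * (x + y) - + 2 * (x - y)
        lemma = ℤ-RingSolver.solve-∀

    equal-pair : x - y ≡ + 0 → + 4 * x ≡ N + t × + 4 * y ≡ N + t
    equal-pair d≡0 = trans (4x≡ d≡0) (ℤ.+-identityʳ _) , trans (4y≡ d≡0) (ℤ.+-identityʳ _)

    -- Here `x - y` is `t` or `- t`, so 4x and 4y are `N + t` plus and minus 2t. The sign only
    -- decides which entry becomes the exceptional one.
    unequal-pair : (x - y) * (x - y) ≡ t * t →
                   (+ 4 * x ≡ N + + 3 * t × + 4 * y ≡ N - t) ⊎
                   (+ 4 * y ≡ N + + 3 * t × + 4 * x ≡ N - t)
    unequal-pair d²≡t² with i²≡j²⇒i≡j∨i≡-j (x - y) t d²≡t²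
    ... | inj₁ d≡t  = inj₁ (trans (4x≡ d≡t) (lemma₁ N t) , trans (4y≡ d≡t) (lemma₂ N t))
      where
      lemma₁ : ∀ N t → N + t + + 2 * t ≡ N + + 3 * t
      lemma₁ = ℤ-RingSolver.solve-∀
      lemma₂ : ∀ N t → N + t - + 2 * t ≡ N - t
      lemma₂ = ℤ-RingSolver.solve-∀
    ... | inj₂ d≡-t = inj₂ (trans (4y≡ d≡-t) (lemma₁ N t) , trans (4x≡ d≡-t) (lemma₂ N t))
      where
      lemma₁ : ∀ N t → N + t - + 2 * - t ≡ N + + 3 * t
      lemma₁ = ℤ-RingSolver.solve-∀
      lemma₂ : ∀ N t → N + t + + 2 * - t ≡ N - t
      lemma₂ = ℤ-RingSolver.solve-∀

  -- The root `t` may have either sign: a positive `t` makes entry `k` exceptionally large, a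
  -- negative one exceptionally small, so both distributions of the theorem are covered at once.
  Extremal : ℤ → (Fin 4 → ℤ) → Set
  Extremal N X = ∃[ t ] t * t ≡ N × ∃[ k ] (+ 4 * X k ≡ N + + 3 * t) × (∀ j → j ≢ k → + 4 * X j ≡ N - t)

  -- The normal form, with the exceptional entry in the first pair and two ordinary entries in the
  -- second.
  pairs⇒extremal : ∀ {N} {X : Fin 4 → ℤ} t → t * t ≡ N →
    + 2 * (X 0F + X 1F) ≡ N + t → (X 0F - X 1F) * (X 0F - X 1F) ≡ t * t →
    + 4 * X 2F ≡ N - t × + 4 * X 3F ≡ N - t → Extremal N X
  pairs⇒extremal {N} {X} t t²≡N 2[x+y]≡N+t u²≡t² (4z , 4w)
    with unequal-pair {N} {X 0F} {X 1F} t 2[x+y]≡N+t u²≡t²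
  ... | inj₁ (4x , 4y) = t , t²≡N , 0F , 4x , λ where
    0F 0≢0 → contradiction refl 0≢0 ; 1F _ → 4y ; 2F _ → 4z ; 3F _ → 4w
  ... | inj₂ (4y , 4x) = t , t²≡N , 1F , 4y , λ where
    0F _ → 4x ; 1F 1≢1 → contradiction refl 1≢1 ; 2F _ → 4z ; 3F _ → 4w

  swapPairs : Fin 4 → Fin 4
  swapPairs 0F = 2F
  swapPairs 1F = 3F
  swapPairs 2F = 0F
  swapPairs 3F = 1F

  swapPairs-involutive : ∀ k → swapPairs (swapPairs k) ≡ k
  swapPairs-involutive 0F = refl
  swapPairs-involutive 1F = refl
  swapPairs-involutive 2F = refl
  swapPairs-involutive 3F = refl

  -- Reduces the case of an exceptional entry in the second pair to the normal form.
  extremal-swapPairs : ∀ {N X} → Extremal N (X ∘ swapPairs) → Extremal N X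
  extremal-swapPairs {N} {X} (t , t²≡N , k , 4Xk , 4Xj) = t , t²≡N , swapPairs k , 4Xk , λ j j≢ →
    subst (λ i → + 4 * X i ≡ N - t) (swapPairs-involutive j)
      (4Xj (swapPairs j) λ { refl → j≢ (sym (swapPairs-involutive j)) })

  -- The action of left translation by the involution `b` on the indices of the listing b + d, d, b,
  -- 0 built in `cosetListing`.
  partner : Fin 4 → Fin 4
  partner 0F = 1F
  partner 1F = 0F
  partner 2F = 3F
  partner 3F = 2F

  -- Quadruples with the autocorrelations of a perfect nonlinear function.

  module _ {N : ℤ} {X : Fin 4 → ℤ}
    (Σ≡ : sum X ≡ N)
    (Σ²≡ : + 4 * ∑[ k < 4 ] (X k * X k) + N ≡ + 4 * N + N * N)
    (Σ′≡ : + 4 * ∑[ k < 4 ] (X k * X (partner k)) + N ≡ N * N)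
    where
    open ≡-Reasoning

    private
      x = X 0F
      y = X 1F
      z = X 2F
      w = X 3F

      -- If X sums to N, then 4X - N has sums 2t and -2t over the pairs {0, 1} and {2, 3}.
      t : ℤ
      t = + 2 * (x + y) - N

      -- Subtracting the autocorrelation over partners from the one at 0 completes the squares of
      -- the differences within the pairs.
      u²+v²≡N : (x - y) * (x - y) + (z - w) * (z - w) ≡ N
      u²+v²≡N = ℤ.*-cancelˡ-≡ (+ 4) _ _ (begin
        + 4 * ((x - y) * (x - y) + (z - w) * (z - w)) ≡⟨ lemma₁ x y z w N ⟩
        (+ 4 * (x * x + (y * y + (z * z + (w * w + + 0)))) + N) -
          (+ 4 * (x * y + (y * x + (z * w + (w * z + + 0)))) + N)  ≡⟨ cong₂ _-_ Σ²≡ Σ′≡ ⟩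
        (+ 4 * N + N * N) - N * N  ≡⟨ lemma₂ N ⟩
        + 4 * N  ∎)
        where
        -- The nested sums ending in `+ 0` are what `∑[ k < 4 ]` reduces to, so that the solved
        -- identity fits `Σ²≡` and `Σ′≡`.
        lemma₁ : ∀ x y z w N → + 4 * ((x - y) * (x - y) + (z - w) * (z - w)) ≡
          (+ 4 * (x * x + (y * y + (z * z + (w * w + + 0)))) + N) -
          (+ 4 * (x * y + (y * x + (z * w + (w * z + + 0)))) + N)
        lemma₁ = ℤ-RingSolver.solve-∀
        lemma₂ : ∀ N → (+ 4 * N + N * N) - N * N ≡ + 4 * N
        lemma₂ = ℤ-RingSolver.solve-∀

      2[x+y]≡N+t : + 2 * (x + y) ≡ N + t
      2[x+y]≡N+t = lemma N (+ 2 * (x + y))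
        where
        lemma : ∀ N p → p ≡ N + (p - N)
        lemma = ℤ-RingSolver.solve-∀

      -- The right side has the shape `N + - t` so that the second pair is an instance of the pair
      -- lemmas at `- t`.
      2[z+w]≡N-t : + 2 * (z + w) ≡ N + - t
      2[z+w]≡N-t = begin
        + 2 * (z + w)                                                ≡⟨ lemma x y z w ⟩
        + 2 * (x + (y + (z + (w + + 0)))) - + 2 * (x + y)            ≡⟨ cong (λ s → + 2 * s - + 2 * (x + y)) Σ≡ ⟩
        + 2 * N - + 2 * (x + y)                                      ≡⟨ lemma₂ N (+ 2 * (x + y)) ⟩
        N + - t                                                      ∎
        where
        lemma : ∀ x y z w → + 2 * (z + w) ≡ + 2 * (x + (y + (z + (w + + 0)))) - + 2 * (x + y)
        lemma = ℤ-RingSolver.solve-∀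
        lemma₂ : ∀ N p → + 2 * N - p ≡ N + - (p - N)
        lemma₂ = ℤ-RingSolver.solve-∀

      -- Adding the two autocorrelations completes the squares of the pair sums instead. Doubled and
      -- centred at `N`, these sums are `t` and `- t`, which yields 2t² = 2N.
      t²≡N : t * t ≡ N
      t²≡N = ℤ.*-cancelˡ-≡ (+ 2) _ _ (begin
        + 2 * (t * t)                                                 ≡⟨ lemma₁ t ⟩
        t * t + (- t) * (- t)
          ≡⟨ cong₂ (λ a b → a * a + b * b) (lemma₂ N t 2[x+y]≡N+t) (lemma₂ N (- t) 2[z+w]≡N-t) ⟨
        (p - N) * (p - N) + (q - N) * (q - N)                         ≡⟨ lemma₃ x y z w N ⟩
        (+ 4 * (x * x + (y * y + (z * z + (w * w + + 0)))) + N) +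
          (+ 4 * (x * y + (y * x + (z * w + (w * z + + 0)))) + N)
          - + 4 * N * (x + (y + (z + (w + + 0)))) + + 2 * N * N - + 2 * N
          ≡⟨ cong (λ r → r + + 2 * N * N - + 2 * N)
                  (cong₂ (λ a b → a - + 4 * N * b) (cong₂ _+_ Σ²≡ Σ′≡) Σ≡) ⟩
        (+ 4 * N + N * N) + N * N - + 4 * N * N + + 2 * N * N - + 2 * N ≡⟨ lemma₄ N ⟩
        + 2 * N ∎)
        where
        p = + 2 * (x + y)
        q = + 2 * (z + w)
        lemma₁ : ∀ t → + 2 * (t * t) ≡ t * t + (- t) * (- t)
        lemma₁ = ℤ-RingSolver.solve-∀
        lemma₂ : ∀ N s {r} → r ≡ N + s → r - N ≡ s
        lemma₂ N s refl = lemma N s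
          where
          lemma : ∀ N s → N + s - N ≡ s
          lemma = ℤ-RingSolver.solve-∀
        lemma₃ : ∀ x y z w N →
          (+ 2 * (x + y) - N) * (+ 2 * (x + y) - N) + (+ 2 * (z + w) - N) * (+ 2 * (z + w) - N) ≡
          (+ 4 * (x * x + (y * y + (z * z + (w * w + + 0)))) + N) +
          (+ 4 * (x * y + (y * x + (z * w + (w * z + + 0)))) + N)
          - + 4 * N * (x + (y + (z + (w + + 0)))) + + 2 * N * N - + 2 * N
        lemma₃ = ℤ-RingSolver.solve-∀
        lemma₄ : ∀ N → (+ 4 * N + N * N) + N * N - + 4 * N * N + + 2 * N * N - + 2 * N ≡ + 2 * N
        lemma₄ = ℤ-RingSolver.solve-∀

      u²+v²≡t² : (x - y) * (x - y) + (z - w) * (z - w) ≡ t * t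
      u²+v²≡t² = trans u²+v²≡N (sym t²≡N)

      [-t]²≡t² : (- t) * (- t) ≡ t * t
      [-t]²≡t² = lemma t
        where
        lemma : ∀ t → (- t) * (- t) ≡ t * t
        lemma = ℤ-RingSolver.solve-∀

    -- Since `t²` is a power of 2 and the sum of the squares of `x - y` and `z - w`, one difference
    -- vanishes. The other is then `t` up to sign, and its pair holds the exceptional entry.
    sums⇒extremal : ∀ n → N ≡ + (2 ^ n) → Extremal N X
    sums⇒extremal n N≡2ⁿ = [ u≡0⇒ , v≡0⇒ ]′ (pythagorean-2^n-ℤ n (x - y) (z - w) t (trans t²≡N N≡2ⁿ) u²+v²≡t²)
      where
      u≡0⇒ : x - y ≡ + 0 → Extremal N X
      -- The exceptional entry is in the second pair, where the doubled sum deviates from `N` by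
      -- `- t`; hence the swap and the root `- t`.
      u≡0⇒ u≡0 = extremal-swapPairs {N} {X} (pairs⇒extremal {N} {X ∘ swapPairs} (- t)
        (trans [-t]²≡t² t²≡N) 2[z+w]≡N-t v²≡[-t]² 4x,4y)
        where
        v²≡[-t]² : (z - w) * (z - w) ≡ (- t) * (- t)
        v²≡[-t]² = begin
          (z - w) * (z - w)                          ≡⟨ ℤ.+-identityˡ ((z - w) * (z - w)) ⟨
          + 0 + (z - w) * (z - w)                    ≡⟨ cong (λ u → u * u + (z - w) * (z - w)) u≡0 ⟨
          (x - y) * (x - y) + (z - w) * (z - w)      ≡⟨ u²+v²≡t² ⟩
          t * t                                      ≡⟨ [-t]²≡t² ⟨
          (- t) * (- t)                              ∎
        4x,4y : + 4 * x ≡ N - - t × + 4 * y ≡ N - - t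
        4x,4y = subst (λ s → + 4 * x ≡ N + s × + 4 * y ≡ N + s) (sym (ℤ.neg-involutive t))
          (equal-pair {N} {x} {y} t 2[x+y]≡N+t u≡0)

      v≡0⇒ : z - w ≡ + 0 → Extremal N X
      v≡0⇒ v≡0 = pairs⇒extremal {N} {X} t t²≡N 2[x+y]≡N+t u²≡t² (equal-pair {N} {z} {w} (- t) 2[z+w]≡N-t v≡0)
        where
        u²≡t² : (x - y) * (x - y) ≡ t * t
        u²≡t² = begin
          (x - y) * (x - y)                          ≡⟨ ℤ.+-identityʳ ((x - y) * (x - y)) ⟨
          (x - y) * (x - y) + + 0                    ≡⟨ cong (λ v → (x - y) * (x - y) + v * v) v≡0 ⟨
          (x - y) * (x - y) + (z - w) * (z - w)      ≡⟨ u²+v²≡t² ⟩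
          t * t                                      ∎

-- Counting with sums of indicators.

module Counting where
  open IntegerArithmetic
  open import Data.Integer.Base using (_+_; _*_; _-_; -_)
  open SemiringSum ℤ.+-*-semiring
    using (sum; sum-syntax; sum-cong-≗; ∑-comm; ∑-permute; ∑-distrib-+; *-distribˡ-sum; *-distribʳ-sum)

  private variable
    a b c d ℓ p q : Level
    A : Set a
    P : Set p
    Q : Set q
    m n : ℕ

  ∑-const : ∀ n (i : ℤ) → ∑[ _ < n ] i ≡ + n * i
  ∑-const zero    i = refl
  ∑-const (suc n) i = trans (cong (_+_ i) (∑-const n i)) (sym (ℤ.suc-* (+ n) i))

  ∑-single : ∀ (g : Fin n → ℤ) k → (∀ j → j ≢ k → g j ≡ + 0) → sum g ≡ g k
  ∑-single {suc n} g zero    g≡0 = trans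
    (cong (_+_ (g zero)) (trans (sum-cong-≗ (λ j → g≡0 (suc j) λ ())) (trans (∑-const n (+ 0)) (ℤ.*-zeroʳ (+ n)))))
    (ℤ.+-identityʳ (g zero))
  ∑-single {suc n} g (suc k) g≡0 = trans
    (cong₂ _+_ (g≡0 zero λ ()) (∑-single (g ∘ suc) k (λ j j≢k → g≡0 (suc j) (j≢k ∘ suc-injective))))
    (ℤ.+-identityˡ (g (suc k)))

  -- Once `i` is subtracted from every term, only the one at `k` can survive. The extra `i` on the
  -- left avoids the coefficient n - 1.
  ∑-all-but-one : ∀ (g : Fin n → ℤ) k i → (∀ j → j ≢ k → g j ≡ i) → sum g + i ≡ g k + + n * i
  ∑-all-but-one {n} g k i g≡i = begin
    sum g + i                                  ≡⟨ cong (_+ i) (sum-cong-≗ λ j → lemma₁ (g j) i) ⟩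
    ∑[ j < n ] (g j - i + i) + i               ≡⟨ cong (_+ i) (∑-distrib-+ (λ j → g j - i) (λ _ → i)) ⟩
    ∑[ j < n ] (g j - i) + ∑[ _ < n ] i + i
      ≡⟨ cong₂ (λ u v → u + v + i) (∑-single (λ j → g j - i) k λ j j≢k → ℤ.i≡j⇒i-j≡0 (g≡i j j≢k)) (∑-const n i) ⟩
    g k - i + + n * i + i                      ≡⟨ lemma₂ (g k) i (+ n * i) ⟩
    g k + + n * i                              ∎
    where
    open ≡-Reasoning
    lemma₁ : ∀ u v → u ≡ u - v + v
    lemma₁ = ℤ-RingSolver.solve-∀
    lemma₂ : ∀ u v w → u - v + w + v ≡ u + w
    lemma₂ = ℤ-RingSolver.solve-∀

  𝟙 : Dec P → ℤ
  𝟙 P? = if does P? then + 1 else + 0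

  𝟙-yes : (P? : Dec P) → P → 𝟙 P? ≡ + 1
  𝟙-yes (yes _) p = refl
  𝟙-yes (no ¬p) p = contradiction p ¬p

  𝟙-no : (P? : Dec P) → ¬ P → 𝟙 P? ≡ + 0
  𝟙-no (yes p) ¬p = contradiction p ¬p
  𝟙-no (no _)  ¬p = refl

  𝟙-cong : (P? : Dec P) (Q? : Dec Q) → (P → Q) → (Q → P) → 𝟙 P? ≡ 𝟙 Q?
  𝟙-cong (yes p) Q? p⇒q q⇒p = sym (𝟙-yes Q? (p⇒q p))
  𝟙-cong (no ¬p) Q? p⇒q q⇒p = sym (𝟙-no Q? (¬p ∘ q⇒p))

  -- Turns the counts behind `card` into sums that can be interchanged and reindexed.
  count-tabulate : {P : Pred A p} (P? : Decidable P) (f : Fin n → A) →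
                   + count P? (tabulate f) ≡ ∑[ i < n ] 𝟙 (P? (f i))
  count-tabulate {n = zero}  P? f = refl
  count-tabulate {n = suc n} P? f with P? (f zero)
  ... | yes _ = cong (_+_ (+ 1)) (count-tabulate P? (f ∘ suc))
  ... | no  _ = trans (count-tabulate P? (f ∘ suc)) (sym (ℤ.+-identityˡ _))

  -- Listings of group elements, and groups of order 4.

  module FiniteGroupProperties (H : FiniteGroup c d) where
    open FiniteGroup H public
      using (Carrier; _≈_; order; group; enumeration; index; element; _≟_; 0#)
      renaming (_+_ to _⊕_; -_ to ⊖_; _-_ to _⊝_)
    open Group group public
      using (assoc; identityˡ; identityʳ; inverseʳ)
      renaming (refl to ≈-refl; sym to ≈-sym; trans to ≈-trans; reflexive to ≈-reflexive;
                ∙-congˡ to ⊕-congˡ; ∙-congʳ to ⊕-congʳ)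
    open GroupProperties group public
      using (identityˡ-unique; identityʳ-unique; ε⁻¹≈ε; ⁻¹-involutive; ⁻¹-injective;
             \\-leftDividesˡ; \\-leftDividesʳ; //-rightDividesˡ; //-rightDividesʳ)

    element-index : ∀ x → element (index x) ≈ x
    element-index = Inverse.strictlyInverseʳ enumeration

    index-injective : ∀ {x y} → index x ≡ index y → x ≈ y
    index-injective {x} {y} eq = ≈-trans (≈-sym (element-index x))
      (≈-trans (≈-reflexive (cong element eq)) (element-index y))

    index-element : ∀ i → index (element i) ≡ i
    index-element = Inverse.strictlyInverseˡ enumeration

    index-cong : ∀ {x y} → x ≈ y → index x ≡ index y
    index-cong = Inverse.to-cong enumeration

    Distinct : Vector Carrier n → Set d
    Distinct xs = ∀ i j → xs i ≈ xs j → i ≡ j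

    Fresh : Carrier → Vector Carrier n → Set d
    Fresh x xs = ∀ i → ¬ (xs i ≈ x)

    distinct-[] : Distinct []
    distinct-[] ()

    distinct-∷ : ∀ {x} {xs : Vector Carrier n} → Fresh x xs → Distinct xs → Distinct (x ∷ xs)
    distinct-∷ x∉ d zero    zero    eq = refl
    distinct-∷ x∉ d zero    (suc j) eq = contradiction (≈-sym eq) (x∉ j)
    distinct-∷ x∉ d (suc i) zero    eq = contradiction eq (x∉ i)
    distinct-∷ x∉ d (suc i) (suc j) eq = cong suc (d i j eq)

    distinct⇒≤ : {xs : Vector Carrier n} → Distinct xs → n ℕ.≤ order
    distinct⇒≤ d = injective⇒≤ (λ eq → d _ _ (index-injective eq))

    -- Pigeonhole: if every index were hit, choosing a position for each would inject `Fin order`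
    -- into `Fin n`. Decidability of being hit turns this refutation into a witness.
    fresh : (xs : Vector Carrier n) → n ℕ.< order → ∃ λ x → Fresh x xs
    fresh xs n<order = Product.map element (λ {k} ¬∃ i eq → ¬∃ (i , (trans (index-cong eq) (index-element k))))
      (¬∀⟶∃¬ order _ (λ k → any? λ i → index (xs i) ≟ᶠ k) λ hit → ℕ.<⇒≱ n<order
        (injective⇒≤ {f = proj₁ ∘ hit} λ {k} {l} eq →
          trans (sym (proj₂ (hit k))) (trans (cong (index ∘ xs) eq) (proj₂ (hit l)))))

    -- A missing element could be prepended, giving more distinct elements than the group has.
    exhaustive : {xs : Vector Carrier n} → Distinct xs → order ≡ n → ∀ x → ∃ λ i → xs i ≈ x
    exhaustive {xs = xs} d order≡n x with any? (λ i → xs i ≟ x)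
    ... | yes i,eq = i,eq
    ... | no  ¬∃   = contradiction (distinct⇒≤ (distinct-∷ (λ i eq → ¬∃ (i , eq)) d))
                       (ℕ.<⇒≱ (ℕ.s≤s (ℕ.≤-reflexive order≡n)))

    -- If a ≠ -a, then the fourth element besides 0, a and -a must be its own inverse.
    involution : order ≡ 4 → ∃ λ b → ¬ (b ≈ 0#) × (b ⊕ b ≈ 0#)
    involution order≡4 with fresh (0# ∷ []) (ℕ.<-≤-trans (ℕ.s≤s (ℕ.s≤s ℕ.z≤n)) (ℕ.≤-reflexive (sym order≡4)))
    ... | a , a∉ with a ⊕ a ≟ 0#
    ...   | yes 2a≈0 = a , (λ a≈0 → a∉ 0F (≈-sym a≈0)) , 2a≈0
    ...   | no  2a≉0 with fresh (⊖ a ∷ a ∷ 0# ∷ []) (ℕ.≤-reflexive (sym order≡4))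
    ...     | c , c∉ = c , (λ c≈0 → c∉ 2F (≈-sym c≈0)) , 2c≈0
      where
      -a∉ : Fresh (⊖ a) (a ∷ 0# ∷ [])
      -a∉ 0F a≈-a = 2a≉0 (≈-trans (⊕-congˡ a≈-a) (inverseʳ a))
      -a∉ 1F 0≈-a = a∉ 0F (⁻¹-injective (≈-trans ε⁻¹≈ε 0≈-a))

      xs : Vector Carrier 4
      xs = c ∷ ⊖ a ∷ a ∷ 0# ∷ []

      distinct : Distinct xs
      distinct = distinct-∷ c∉ (distinct-∷ -a∉ (distinct-∷ a∉ (distinct-∷ (λ ()) distinct-[])))

      2c≈0 : c ⊕ c ≈ 0#
      2c≈0 with exhaustive distinct order≡4 (⊖ c)
      ... | 0F , c≈-c  = ≈-trans (⊕-congˡ c≈-c) (inverseʳ c)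
      ... | 1F , -a≈-c = contradiction (⁻¹-injective -a≈-c) (c∉ 1F)
      ... | 2F , a≈-c  = contradiction (⁻¹-injective (≈-trans (⁻¹-involutive a) a≈-c)) (c∉ 0F)
      ... | 3F , 0≈-c  = contradiction (⁻¹-injective (≈-trans ε⁻¹≈ε 0≈-c)) (c∉ 2F)

    -- An element `d` outside the subgroup {b, 0} yields the other right coset {b + d, d}. Because b
    -- + b = 0, left translation by `b` exchanges the two members of each coset.
    cosetListing : order ≡ 4 → ∃ λ b → ¬ (b ≈ 0#) × ∃ λ xs → Distinct xs × (∀ k → xs (partner k) ≈ b ⊕ xs k)
    cosetListing order≡4 with involution order≡4
    ... | b , b≉0 , 2b≈0 with fresh (b ∷ 0# ∷ []) (ℕ.<-≤-trans (ℕ.s≤s (ℕ.s≤s (ℕ.s≤s ℕ.z≤n))) (ℕ.≤-reflexive (sym order≡4)))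
    ...   | d , d∉ = b , b≉0 , xs , distinct , translate
      where
      xs : Vector Carrier 4
      xs = b ⊕ d ∷ d ∷ b ∷ 0# ∷ []

      b∉ : Fresh b (0# ∷ [])
      b∉ 0F 0≈b = b≉0 (≈-sym 0≈b)

      b+b+x≈x : ∀ x → x ≈ b ⊕ (b ⊕ x)
      b+b+x≈x x = ≈-trans (≈-sym (identityˡ x)) (≈-trans (⊕-congʳ (≈-sym 2b≈0)) (assoc b b x))

      b+d∉ : Fresh (b ⊕ d) (d ∷ b ∷ 0# ∷ [])
      b+d∉ 0F d≈b+d = b≉0 (identityˡ-unique b d (≈-sym d≈b+d))
      b+d∉ 1F b≈b+d = d∉ 1F (≈-sym (identityʳ-unique b d (≈-sym b≈b+d)))
      b+d∉ 2F 0≈b+d = d∉ 0F (≈-trans (≈-sym (identityʳ b)) (≈-trans (⊕-congˡ 0≈b+d) (≈-sym (b+b+x≈x d))))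

      distinct : Distinct xs
      distinct = distinct-∷ b+d∉ (distinct-∷ d∉ (distinct-∷ b∉ (distinct-∷ (λ ()) distinct-[])))

      translate : ∀ k → xs (partner k) ≈ b ⊕ xs k
      translate 0F = b+b+x≈x d
      translate 1F = ≈-refl
      translate 2F = ≈-sym 2b≈0
      translate 3F = ≈-sym (identityʳ b)

  -- Preimage sizes and counts of differences.

  module FibreCounting (G : FiniteGroup a b) (H : FiniteGroup c d) (F : GroupFunction G H) where
    private
      module G = FiniteGroupProperties G
      module H = FiniteGroupProperties H
      open G using (_⊕_; ⊖_)
      open Func F using () renaming (to to f; cong to f-cong)
      fᵢ : Fin G.order → H.Carrier
      fᵢ i = f (G.element i)
      N : ℤ
      N = + G.order

    preimage : H.Carrier → ℤ
    preimage β = ∑[ i < G.order ] 𝟙 (fᵢ i H.≟ β)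

    -- The entry of the difference distribution table of `F` at input difference `u` and output
    -- difference `v`.
    derivative : G.Carrier → H.Carrier → ℤ
    derivative u v = ∑[ i < G.order ] 𝟙 ((f (G.element i ⊕ u) H.⊝ fᵢ i) H.≟ v)

    preimage-cong : ∀ {β γ} → β H.≈ γ → preimage β ≡ preimage γ
    preimage-cong {β} {γ} β≈γ = sum-cong-≗ {G.order} λ i →
      𝟙-cong (fᵢ i H.≟ β) (fᵢ i H.≟ γ) (λ eq → H.≈-trans eq β≈γ) (λ eq → H.≈-trans eq (H.≈-sym β≈γ))

    -- Left translation by `g` on indices, used to replace a summation over y by one over u with y =
    -- g + u.
    shift : G.Carrier → Permutation G.order G.order
    shift g = permutation (λ i → G.index (g ⊕ G.element i)) (λ i → G.index (⊖ g ⊕ G.element i))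
      (λ i → trans (G.index-cong (G.≈-trans (G.⊕-congˡ (G.element-index _)) (G.\\-leftDividesˡ g _))) (G.index-element i))
      (λ i → trans (G.index-cong (G.≈-trans (G.⊕-congˡ (G.element-index _)) (G.\\-leftDividesʳ g _))) (G.index-element i))

    -- For fixed x, every y is x + u for exactly one u. Reindexing the inner sum this way and
    -- interchanging the sums groups the pairs by u.
    ∑-differences : ∀ v → ∑[ i < G.order ] ∑[ j < G.order ] 𝟙 ((fᵢ j H.⊝ fᵢ i) H.≟ v) ≡
                          ∑[ u < G.order ] derivative (G.element u) v
    ∑-differences v = trans
      (sum-cong-≗ {G.order} λ i → trans
        (∑-permute (λ j → 𝟙 ((fᵢ j H.⊝ fᵢ i) H.≟ v)) (shift (G.element i)))
        (sum-cong-≗ {G.order} λ u → 𝟙-cong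
          ((fᵢ (shift (G.element i) ⟨$⟩ʳ u) H.⊝ fᵢ i) H.≟ v)
          ((f (G.element i ⊕ G.element u) H.⊝ fᵢ i) H.≟ v)
          (H.≈-trans (H.≈-sym (shifted i u))) (H.≈-trans (shifted i u))))
      (∑-comm {G.order} {G.order} λ i u → 𝟙 ((f (G.element i ⊕ G.element u) H.⊝ fᵢ i) H.≟ v))
      where
      shifted : ∀ i u → (fᵢ (shift (G.element i) ⟨$⟩ʳ u) H.⊝ fᵢ i) H.≈ (f (G.element i ⊕ G.element u) H.⊝ fᵢ i)
      shifted i u = H.⊕-congʳ (f-cong (G.element-index (G.element i ⊕ G.element u)))

    derivative-0 : ∀ {u v} → u G.≈ G.0# → derivative u v ≡ N * 𝟙 (H.0# H.≟ v)
    derivative-0 {u} {v} u≈0 = trans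
      (sum-cong-≗ λ i → 𝟙-cong (_ H.≟ v) (H.0# H.≟ v) (H.≈-trans (H.≈-sym (zero≈ i))) (H.≈-trans (zero≈ i)))
      (∑-const G.order _)
      where
      zero≈ : ∀ i → f (G.element i ⊕ u) H.⊝ fᵢ i H.≈ H.0#
      zero≈ i = H.≈-trans (H.⊕-congʳ (f-cong (G.≈-trans (G.⊕-congˡ u≈0) (G.identityʳ _)))) (H.inverseʳ (fᵢ i))

    -- Each of the `N` - 1 nonzero shifts contributes `N` after multiplication by 4. The zero shift
    -- has constant difference 0, so it counts all of G when `v` is 0 and nothing otherwise.
    ∑-derivative : ∀ v → (∀ u → ¬ (u G.≈ G.0#) → + 4 * derivative u v ≡ N) →
      + 4 * ∑[ u < G.order ] derivative (G.element u) v + N ≡ + 4 * (N * 𝟙 (H.0# H.≟ v)) + N * N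
    ∑-derivative v perfect = begin
      + 4 * ∑[ u < G.order ] derivative (G.element u) v + N
        ≡⟨ cong (_+ N) (*-distribˡ-sum (+ 4) (λ u → derivative (G.element u) v)) ⟩
      ∑[ u < G.order ] (+ 4 * derivative (G.element u) v) + N
        ≡⟨ ∑-all-but-one (λ u → + 4 * derivative (G.element u) v) (G.index G.0#) N (λ u u≢0 → perfect (G.element u)
             λ u≈0 → u≢0 (trans (sym (G.index-element u)) (G.index-cong u≈0))) ⟩
      + 4 * derivative (G.element (G.index G.0#)) v + N * N
        ≡⟨ cong (λ d → + 4 * d + N * N) (derivative-0 (G.element-index G.0#)) ⟩
      + 4 * (N * 𝟙 (H.0# H.≟ v)) + N * N ∎
      where
      open ≡-Reasoning

    module _ {m} {xs : Vector H.Carrier m} (distinct : H.Distinct xs) (order≡m : H.order ≡ m) where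
      open ≡-Reasoning

      -- Exactly one listed element equals `h`, so one indicator survives. Its index is returned
      -- because `∑-autocorrelation` needs to know which element it lists.
      ∑-listing : ∀ h (g : Fin m → ℤ) → ∃ λ k → (xs k H.≈ h) × ∑[ k < m ] (𝟙 (h H.≟ xs k) * g k) ≡ g k
      ∑-listing h g with k , xₖ≈h ← H.exhaustive distinct order≡m h = k , xₖ≈h , (begin
        ∑[ k < m ] (𝟙 (h H.≟ xs k) * g k)
          ≡⟨ ∑-single _ k (λ j j≢k → cong (_* g j) (𝟙-no (h H.≟ xs j)
               λ h≈xⱼ → j≢k (distinct j k (H.≈-trans (H.≈-sym h≈xⱼ) (H.≈-sym xₖ≈h))))) ⟩
        𝟙 (h H.≟ xs k) * g k   ≡⟨ cong (_* g k) (𝟙-yes (h H.≟ xs k) (H.≈-sym xₖ≈h)) ⟩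
        + 1 * g k              ≡⟨ ℤ.*-identityˡ (g k) ⟩
        g k                    ∎)

      ∑-preimage : ∑[ k < m ] preimage (xs k) ≡ N
      ∑-preimage = begin
        ∑[ k < m ] ∑[ i < G.order ] 𝟙 (fᵢ i H.≟ xs k)   ≡⟨ ∑-comm (λ k i → 𝟙 (fᵢ i H.≟ xs k)) ⟩
        ∑[ i < G.order ] ∑[ k < m ] 𝟙 (fᵢ i H.≟ xs k)   ≡⟨ sum-cong-≗ one ⟩
        ∑[ i < G.order ] (+ 1)                            ≡⟨ ∑-const G.order (+ 1) ⟩
        N * + 1                                         ≡⟨ ℤ.*-identityʳ N ⟩
        N                                               ∎
        where
        one : ∀ i → ∑[ k < m ] 𝟙 (fᵢ i H.≟ xs k) ≡ + 1
        one i = trans (sum-cong-≗ λ k → sym (ℤ.*-identityʳ (𝟙 (fᵢ i H.≟ xs k))))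
          (proj₂ (proj₂ (∑-listing (fᵢ i) (λ _ → + 1))))

      -- A product of sizes counts pairs (i, j) with `fᵢ i` equal to β and `fᵢ j` equal to v + β.
      -- Summed over β, these are the pairs with `fᵢ j` - `fᵢ i` equal to `v`; the index map `τ`
      -- represents β to v + β.
      ∑-autocorrelation : ∀ v (τ : Fin m → Fin m) → (∀ k → xs (τ k) H.≈ v H.⊕ xs k) →
        ∑[ k < m ] (preimage (xs k) * preimage (xs (τ k))) ≡ ∑[ u < G.order ] derivative (G.element u) v
      ∑-autocorrelation v τ xτ≈v+x = begin
        ∑[ k < m ] (preimage (xs k) * preimage (xs (τ k)))
          ≡⟨ sum-cong-≗ (λ k → *-distribʳ-sum (preimage (xs (τ k))) (λ i → 𝟙 (fᵢ i H.≟ xs k))) ⟩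
        ∑[ k < m ] ∑[ i < G.order ] (𝟙 (fᵢ i H.≟ xs k) * preimage (xs (τ k)))
          ≡⟨ ∑-comm (λ k i → 𝟙 (fᵢ i H.≟ xs k) * preimage (xs (τ k))) ⟩
        ∑[ i < G.order ] ∑[ k < m ] (𝟙 (fᵢ i H.≟ xs k) * preimage (xs (τ k)))
          ≡⟨ sum-cong-≗ pairs ⟩
        ∑[ i < G.order ] ∑[ j < G.order ] 𝟙 ((fᵢ j H.⊝ fᵢ i) H.≟ v)
          ≡⟨ ∑-differences v ⟩
        ∑[ u < G.order ] derivative (G.element u) v ∎
        where
        pairs : ∀ i → ∑[ k < m ] (𝟙 (fᵢ i H.≟ xs k) * preimage (xs (τ k))) ≡
                      ∑[ j < G.order ] 𝟙 ((fᵢ j H.⊝ fᵢ i) H.≟ v)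
        pairs i with k , xₖ≈fᵢ , eq ← ∑-listing (fᵢ i) (λ k → preimage (xs (τ k))) = trans eq (sum-cong-≗ λ j →
          𝟙-cong (fᵢ j H.≟ xs (τ k)) ((fᵢ j H.⊝ fᵢ i) H.≟ v)
            (λ fⱼ≈ → H.≈-trans (H.⊕-congʳ (H.≈-trans fⱼ≈ x≈)) (H.//-rightDividesʳ (fᵢ i) v))
            (λ ≈v → H.≈-trans (H.≈-sym (H.//-rightDividesˡ (fᵢ i) (fᵢ j))) (H.≈-trans (H.⊕-congʳ ≈v) (H.≈-sym x≈))))
          where
          x≈ : xs (τ k) H.≈ v H.⊕ fᵢ i
          x≈ = H.≈-trans (xτ≈v+x k) (H.⊕-congˡ xₖ≈fᵢ)

      autocorrelation-0 : (∀ u → ¬ (u G.≈ G.0#) → + 4 * derivative u H.0# ≡ N) →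
        + 4 * ∑[ k < m ] (preimage (xs k) * preimage (xs k)) + N ≡ + 4 * N + N * N
      autocorrelation-0 perfect = begin
        + 4 * ∑[ k < m ] (preimage (xs k) * preimage (xs k)) + N
          ≡⟨ cong (λ s → + 4 * s + N) (∑-autocorrelation H.0# id (λ k → H.≈-sym (H.identityˡ (xs k)))) ⟩
        + 4 * ∑[ u < G.order ] derivative (G.element u) H.0# + N
          ≡⟨ ∑-derivative H.0# perfect ⟩
        + 4 * (N * 𝟙 (H.0# H.≟ H.0#)) + N * N
          ≡⟨ cong (λ i → + 4 * (N * i) + N * N) (𝟙-yes (H.0# H.≟ H.0#) H.≈-refl) ⟩
        + 4 * (N * + 1) + N * N
          ≡⟨ cong (λ i → + 4 * i + N * N) (ℤ.*-identityʳ N) ⟩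
        + 4 * N + N * N ∎

      autocorrelation-≉0 : ∀ {v} (τ : Fin m → Fin m) → ¬ (v H.≈ H.0#) → (∀ k → xs (τ k) H.≈ v H.⊕ xs k) →
        (∀ u → ¬ (u G.≈ G.0#) → + 4 * derivative u v ≡ N) →
        + 4 * ∑[ k < m ] (preimage (xs k) * preimage (xs (τ k))) + N ≡ N * N
      autocorrelation-≉0 {v} τ v≉0 xτ≈v+x perfect = begin
        + 4 * ∑[ k < m ] (preimage (xs k) * preimage (xs (τ k))) + N
          ≡⟨ cong (λ s → + 4 * s + N) (∑-autocorrelation v τ xτ≈v+x) ⟩
        + 4 * ∑[ u < G.order ] derivative (G.element u) v + N
          ≡⟨ ∑-derivative v perfect ⟩
        + 4 * (N * 𝟙 (H.0# H.≟ v)) + N * N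
          ≡⟨ cong (λ i → + 4 * (N * i) + N * N) (𝟙-no (H.0# H.≟ v) (v≉0 ∘ H.≈-sym)) ⟩
        + 4 * (N * + 0) + N * N
          ≡⟨ cong (λ i → + 4 * i + N * N) (ℤ.*-zeroʳ N) ⟩
        + 0 + N * N
          ≡⟨ ℤ.+-identityˡ (N * N) ⟩
        N * N ∎

-- Passage between integers and rationals.

open IntegerArithmetic
open Counting

open import Data.Rational.Base using (ℚ; _+_; _-_; _*_)
open FiniteGroup using (Carrier; order)

fromℚᵘ-homo-+ : ∀ p q → fromℚᵘ (p ℚᵘ.+ q) ≡ fromℚᵘ p + fromℚᵘ q
fromℚᵘ-homo-+ p q = ℚ.toℚᵘ-injective (begin
  toℚᵘ (fromℚᵘ (p ℚᵘ.+ q))                   ≈⟨ ℚ.toℚᵘ-fromℚᵘ (p ℚᵘ.+ q) ⟩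
  p ℚᵘ.+ q                                     ≈⟨ ℚᵘ.+-cong (ℚ.toℚᵘ-fromℚᵘ p) (ℚ.toℚᵘ-fromℚᵘ q) ⟨
  toℚᵘ (fromℚᵘ p) ℚᵘ.+ toℚᵘ (fromℚᵘ q)     ≈⟨ ℚ.toℚᵘ-homo-+ (fromℚᵘ p) (fromℚᵘ q) ⟨
  toℚᵘ (fromℚᵘ p + fromℚᵘ q)                 ∎)
  where open ℚᵘ.≃-Reasoning

fromℚᵘ-homo-* : ∀ p q → fromℚᵘ (p ℚᵘ.* q) ≡ fromℚᵘ p * fromℚᵘ q
fromℚᵘ-homo-* p q = ℚ.toℚᵘ-injective (begin
  toℚᵘ (fromℚᵘ (p ℚᵘ.* q))                   ≈⟨ ℚ.toℚᵘ-fromℚᵘ (p ℚᵘ.* q) ⟩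
  p ℚᵘ.* q                                     ≈⟨ ℚᵘ.*-cong (ℚ.toℚᵘ-fromℚᵘ p) (ℚ.toℚᵘ-fromℚᵘ q) ⟨
  toℚᵘ (fromℚᵘ p) ℚᵘ.* toℚᵘ (fromℚᵘ q)     ≈⟨ ℚ.toℚᵘ-homo-* (fromℚᵘ p) (fromℚᵘ q) ⟨
  toℚᵘ (fromℚᵘ p * fromℚᵘ q)                 ∎)
  where open ℚᵘ.≃-Reasoning

/1-homo-+ : ∀ i j → (i ℤ.+ j) / 1 ≡ i / 1 + j / 1
/1-homo-+ i j = trans
  -- Over denominators 1 the unnormalised sum has numerator i * 1 + j * 1.
  (cong (_/ 1) (sym (cong₂ ℤ._+_ (ℤ.*-identityʳ i) (ℤ.*-identityʳ j))))
  (fromℚᵘ-homo-+ (mkℚᵘ i 0) (mkℚᵘ j 0))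

/1-homo-* : ∀ i j → (i ℤ.* j) / 1 ≡ i / 1 * (j / 1)
/1-homo-* i j = fromℚᵘ-homo-* (mkℚᵘ i 0) (mkℚᵘ j 0)

i/4≡i/1*1/4 : ∀ i → i / 4 ≡ i / 1 * (+ 1 / 4)
i/4≡i/1*1/4 i = trans (cong (_/ 4) (sym (ℤ.*-identityʳ i))) (fromℚᵘ-homo-* (mkℚᵘ i 0) (mkℚᵘ (+ 1) 3))

-- Clears the denominator |H| = 4 in perfect nonlinearity, so that the counting can stay in the
-- integers.
j/1≡i/4⇒4j≡i : ∀ i j → j / 1 ≡ i / 4 → + 4 ℤ.* j ≡ i
j/1≡i/4⇒4j≡i i j eq with *≡* j*4≡i*1 ← ℚ./-injective-≃ (mkℚᵘ j 0) (mkℚᵘ i 3) eq =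
  trans (ℤ.*-comm (+ 4) j) (trans j*4≡i*1 (ℤ.*-identityʳ i))

-- The coefficient `k` is kept general, since the two distributions need 3, -1, -3 and 1.
4j≡i+kr⇒j/1≡ : ∀ {i j} k r → + 4 ℤ.* j ≡ i ℤ.+ k ℤ.* r → j / 1 ≡ (i / 1 + k / 1 * (r / 1)) * (+ 1 / 4)
4j≡i+kr⇒j/1≡ {i} {j} k r eq = begin
  j / 1
    ≡⟨ solve 1 (λ x → x := (con (+ 4 / 1) :* x) :* con (+ 1 / 4)) refl (j / 1) ⟩
  (+ 4 / 1) * (j / 1) * (+ 1 / 4)             ≡⟨ cong (_* (+ 1 / 4)) (/1-homo-* (+ 4) j) ⟨
  ((+ 4 ℤ.* j) / 1) * (+ 1 / 4)               ≡⟨ cong (λ m → m / 1 * (+ 1 / 4)) eq ⟩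
  ((i ℤ.+ k ℤ.* r) / 1) * (+ 1 / 4)
    ≡⟨ cong (_* (+ 1 / 4)) (trans (/1-homo-+ i (k ℤ.* r)) (cong (λ m → i / 1 + m) (/1-homo-* k r))) ⟩
  (i / 1 + k / 1 * (r / 1)) * (+ 1 / 4)       ∎
  where
  open ≡-Reasoning
  open +-*-Solver

∣G∣/∣H∣≡∣G∣/1*¼ : ∀ {a b c d} (G : FiniteGroup a b) (H : FiniteGroup c d) → order H ≡ 4 →
                ∣ G ∣/∣ H ∣ ≡ + order G / 1 * (+ 1 / 4)
∣G∣/∣H∣≡∣G∣/1*¼ G H ∣H∣≡4 = trans
  (ℚ./-cong {+ order G} {order H} ⦃ FiniteGroup.order-nonZero H ⦄ refl ∣H∣≡4) (i/4≡i/1*1/4 (+ order G))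

1/∣H∣≡¼ : ∀ {c d} (H : FiniteGroup c d) → order H ≡ 4 → 1/∣ H ∣ ≡ + 1 / 4
1/∣H∣≡¼ H ∣H∣≡4 = ℚ./-cong {+ 1} {order H} ⦃ FiniteGroup.order-nonZero H ⦄ refl ∣H∣≡4

module _ {g h : ℚ} (p q : ℚ) where
  open +-*-Solver

  -- With `p` = |G| and `q` = √|G|, writing -3/4 as -1 + 1/4 produces the two separate root terms of
  -- the theorem.
  [p-3q]¼ : g ≡ p * (+ 1 / 4) → h ≡ + 1 / 4 → (p + (ℤ.- + 3) / 1 * q) * (+ 1 / 4) ≡ g - q + q * h
  [p-3q]¼ refl refl = solve 2 (λ p q →
    (p :+ con ((ℤ.- + 3) / 1) :* q) :* con (+ 1 / 4) := p :* con (+ 1 / 4) :- q :+ q :* con (+ 1 / 4)) refl p q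

  [p+q]¼ : g ≡ p * (+ 1 / 4) → h ≡ + 1 / 4 → (p + + 1 / 1 * q) * (+ 1 / 4) ≡ g + q * h
  [p+q]¼ refl refl = solve 2 (λ p q →
    (p :+ con (+ 1 / 1) :* q) :* con (+ 1 / 4) := p :* con (+ 1 / 4) :+ q :* con (+ 1 / 4)) refl p q

  [p+3q]¼ : g ≡ p * (+ 1 / 4) → h ≡ + 1 / 4 → (p + + 3 / 1 * q) * (+ 1 / 4) ≡ g + q - q * h
  [p+3q]¼ refl refl = solve 2 (λ p q →
    (p :+ con (+ 3 / 1) :* q) :* con (+ 1 / 4) := p :* con (+ 1 / 4) :+ q :- q :* con (+ 1 / 4)) refl p q

  [p-q]¼ : g ≡ p * (+ 1 / 4) → h ≡ + 1 / 4 → (p + (ℤ.- + 1) / 1 * q) * (+ 1 / 4) ≡ g - q * h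
  [p-q]¼ refl refl = solve 2 (λ p q →
    (p :+ con ((ℤ.- + 1) / 1) :* q) :* con (+ 1 / 4) := p :* con (+ 1 / 4) :- q :* con (+ 1 / 4)) refl p q

-- The preimage distribution of a perfect nonlinear function.

module _ {a b c d} (G : FiniteGroup a b) (H : FiniteGroup c d) (F : GroupFunction G H) where
  private
    module G = FiniteGroup G
    module H = FiniteGroupProperties H
    open Func F using () renaming (to to f)
  open FibreCounting G H F

  perfect⇒derivative : order H ≡ 4 → PerfectNonlinear G H F →
    ∀ v u → ¬ (u G.≈ G.0#) → + 4 ℤ.* derivative u v ≡ + order G
  perfect⇒derivative ∣H∣≡4 perfect v u u≉0 = trans
    (cong (ℤ._*_ (+ 4)) (sym (count-tabulate derivative? G.element)))
    (j/1≡i/4⇒4j≡i (+ order G) (+ G.card derivative?) (trans (perfect u u≉0 v)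
      (ℚ./-cong {+ order G} {order H} ⦃ FiniteGroup.order-nonZero H ⦄ refl ∣H∣≡4)))
    where
    derivative? : Decidable (λ x → (f (x G.+ u) H.⊝ f x) H.≈ v)
    derivative? x = (f (x G.+ u) H.⊝ f x) H.≟ v

  -- The autocorrelations at 0 and at the involution `b`, read along the coset listing, are the
  -- hypotheses of `sums⇒extremal`.
  extremal-preimages : ∀ n → order G ≡ 2 ^ n → order H ≡ 4 → PerfectNonlinear G H F →
    ∃[ xs ] (∀ β → ∃[ k ] xs k H.≈ β) × Extremal (+ order G) (preimage ∘ xs)
  extremal-preimages n ∣G∣≡2ⁿ ∣H∣≡4 perfect =
    let b , b≉0 , xs , distinct , translate = H.cosetListing ∣H∣≡4 in
    xs , H.exhaustive distinct ∣H∣≡4 ,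
    sums⇒extremal {+ order G} {preimage ∘ xs}
      (∑-preimage distinct ∣H∣≡4)
      (autocorrelation-0 distinct ∣H∣≡4 (perfect⇒derivative ∣H∣≡4 perfect H.0#))
      (autocorrelation-≉0 distinct ∣H∣≡4 partner b≉0 translate (perfect⇒derivative ∣H∣≡4 perfect b))
      n (cong +_ ∣G∣≡2ⁿ)

  ∣preimage∣≡ : ∀ {β γ} k r → γ H.≈ β → + 4 ℤ.* preimage γ ≡ + order G ℤ.+ k ℤ.* r →
    ∣preimage∣ G H F β ≡ (+ order G / 1 + k / 1 * (r / 1)) * (+ 1 / 4)
  ∣preimage∣≡ {β} {γ} k r γ≈β eq = trans
    (cong (_/ 1) (trans (count-tabulate (λ x → f x H.≟ β) G.element) (preimage-cong (H.≈-sym γ≈β))))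
    (4j≡i+kr⇒j/1≡ {+ order G} {preimage γ} k r eq)

  -- Passes from indices to elements: any β is some listed `xs j`, and j = i would make it equal to
  -- the exceptional element `xs i`.
  preimage-values : ∀ {xs : Vector H.Carrier 4} → (∀ β → ∃[ k ] xs k H.≈ β) → ∀ {p q} k l r i →
    + 4 ℤ.* preimage (xs i) ≡ + order G ℤ.+ k ℤ.* r →
    (∀ j → j ≢ i → + 4 ℤ.* preimage (xs j) ≡ + order G ℤ.+ l ℤ.* r) →
    (+ order G / 1 + k / 1 * (r / 1)) * (+ 1 / 4) ≡ p →
    (+ order G / 1 + l / 1 * (r / 1)) * (+ 1 / 4) ≡ q →
    ∃[ α ] (∣preimage∣ G H F α ≡ p) × (∀ β → ¬ (β H.≈ α) → ∣preimage∣ G H F β ≡ q)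
  preimage-values {xs} exhaustive k l r i 4Xᵢ 4Xⱼ ≡p ≡q =
    xs i , trans (∣preimage∣≡ k r H.≈-refl 4Xᵢ) ≡p , λ β β≉xᵢ →
      let j , xⱼ≈β = exhaustive β in
      trans (∣preimage∣≡ l r xⱼ≈β (4Xⱼ j λ { refl → β≉xᵢ (H.≈-sym xⱼ≈β) })) ≡q

+r/1-isSqrtOf : ∀ r m → + r ℤ.* + r ≡ + m → ℕ→ℚ r IsSqrtOf m
+r/1-isSqrtOf r m r²≡m =
  ℚ.nonNegative⁻¹ (ℕ→ℚ r) ⦃ ℚ.normalize-nonNeg r 1 ⦄ ,
  trans (sym (/1-homo-* (+ r) (+ r))) (cong (_/ 1) r²≡m)

theorem5p10 : ∀ {a b c d} (G : FiniteGroup a b) (H : FiniteGroup c d) (n : ℕ) →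
    order G ≡ 2 ^ n → order H ≡ 4 →
    (F : GroupFunction G H) → PerfectNonlinear G H F →
    ∃[ √∣G∣ ] (√∣G∣ IsSqrtOf order G) ×
    ( (∃[ α ] (∣preimage∣ G H F α ≡ ∣ G ∣/∣ H ∣ - √∣G∣ + √∣G∣ * 1/∣ H ∣) ×
    (∀ (β : Carrier H) → ¬ (FiniteGroup._≈_ H β α) →
    ∣preimage∣ G H F β ≡ ∣ G ∣/∣ H ∣ + √∣G∣ * 1/∣ H ∣))
    ⊎ (∃[ α ] (∣preimage∣ G H F α ≡ ∣ G ∣/∣ H ∣ + √∣G∣ - √∣G∣ * 1/∣ H ∣) ×
    (∀ (β : Carrier H) → ¬ (FiniteGroup._≈_ H β α) →
    ∣preimage∣ G H F β ≡ ∣ G ∣/∣ H ∣ - √∣G∣ * 1/∣ H ∣)))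
theorem5p10 G H n ∣G∣≡2ⁿ ∣H∣≡4 F perfect =
  case extremal-preimages G H F n ∣G∣≡2ⁿ ∣H∣≡4 perfect of λ where
    -- A nonnegative root is √|G| itself, and the exceptional preimage has size (|G| + 3r)/4, the
    -- large one.
    (xs , exhaustive , + r , r²≡∣G∣ , i , 4Xᵢ , 4Xⱼ) →
      ℕ→ℚ r , +r/1-isSqrtOf r (order G) r²≡∣G∣ ,
      inj₂ (preimage-values G H F exhaustive (+ 3) (ℤ.- + 1) (+ r) i 4Xᵢ
        (λ j j≢i → trans (4Xⱼ j j≢i) (cong (ℤ._+_ (+ order G)) (sym (ℤ.-1*i≡-i (+ r)))))
        ([p+3q]¼ (+ order G / 1) (+ r / 1) g≡ h≡) ([p-q]¼ (+ order G / 1) (+ r / 1) g≡ h≡))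
    -- A negative root is -r with r = m + 1 = √|G|, so |G| + 3t and |G| - t become |G| - 3r and |G|
    -- + r: the exceptional preimage is the small one.
    (xs , exhaustive , -[1+ m ] , t²≡∣G∣ , i , 4Xᵢ , 4Xⱼ) → let r = ℕ.suc m in
      ℕ→ℚ r , +r/1-isSqrtOf r (order G) t²≡∣G∣ ,
      inj₁ (preimage-values G H F exhaustive (ℤ.- + 3) (+ 1) (+ r) i 4Xᵢ
        (λ j j≢i → trans (4Xⱼ j j≢i) (cong (ℤ._+_ (+ order G)) (sym (ℤ.*-identityˡ (+ r)))))
        ([p-3q]¼ (+ order G / 1) (+ r / 1) g≡ h≡) ([p+q]¼ (+ order G / 1) (+ r / 1) g≡ h≡))
  where
  g≡ : ∣ G ∣/∣ H ∣ ≡ + order G / 1 * (+ 1 / 4)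
  g≡ = ∣G∣/∣H∣≡∣G∣/1*¼ G H ∣H∣≡4
  h≡ : 1/∣ H ∣ ≡ + 1 / 4
  h≡ = 1/∣H∣≡¼ H ∣H∣≡4
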